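{- For every odd $n\ge 5$, the $(1,3)$-biased Clique game on $K_n$ is won by player $2$.
   Context: Two players, Alice (player 1, starting) and Bob (player 2), alternately colour uncoloured edges of the complete graph $K_n$, Alice in red and Bob in blue. In the $(p,q)$-biased version Alice colours $p$ edges on each of her turns and Bob colours $q$ edges on each of his turns. In the Clique game, at the end Alice's score is $a=\omega(G[A])$ and Bob's score is $b=\omega(G[B])$, the clique numbers of the graphs formed by the red edges $A$ and the blue edges $B$. When $q>p$, Bob (player 2) wins if at the end $b>a$. Here $(p,q)=(1,3)$. -}

module Defs where

open import Data.Nat using (ℕ; zero; suc; _<_; _⊔_)
open import Data.Bool using (Bool; true; false; _∧_; _∨_; not; if_then_else_)
open import Data.Fin using (Fin; _<?_) renaming (_≟_ to _≟ᶠ_)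
open import Data.Fin.Subset using (Subset; _∈_; ∣_∣)
open import Data.Fin.Subset.Properties using (_∈?_)
open import Data.List using (List; []; _∷_; map; foldr; _++_)
open import Data.Bool.ListAction using (and)
open import Data.List.Base using (allFin)
open import Data.Vec using (Vec; []; _∷_)
open import Data.Maybe using (Maybe; just; nothing)
open import Relation.Binary.PropositionalEquality using (_≡_)
open import Relation.Nullary using (¬_)
open import Relation.Nullary.Decidable using (⌊_⌋)

data Col : Set where
  red blue : Col          -- red = Alice (player 1), blue = Bob (player 2)

colEq : Col → Col → Bool
colEq red  red  = true
colEq blue blue = true
colEq _    _    = false

-- The edge {i,j} (i ≠ j) of K_n has state  c i j  (= c j i):
-- nothing = uncoloured, just x = coloured x.
Colouring : ℕ → Set
Colouring n = Fin n → Fin n → Maybe Col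

empty : (n : ℕ) → Colouring n
empty n _ _ = nothing

paint : {n : ℕ} → Colouring n → Fin n → Fin n → Col → Colouring n
paint c i j x u v =
  if (⌊ u ≟ᶠ i ⌋ ∧ ⌊ v ≟ᶠ j ⌋) ∨ (⌊ u ≟ᶠ j ⌋ ∧ ⌊ v ≟ᶠ i ⌋)
  then just x else c u v

Free : {n : ℕ} → Colouring n → Fin n → Fin n → Set
Free c i j = (i Data.Fin.< j) × (c i j ≡ nothing)
  where open import Data.Product using (_×_)

Full : {n : ℕ} → Colouring n → Set
Full c = ∀ i j → i Data.Fin.< j → ¬ (c i j ≡ nothing)

hasCol : Maybe Col → Col → Bool
hasCol nothing  _ = false
hasCol (just y) x = colEq y x

isClique : {n : ℕ} → Colouring n → Col → Subset n → Bool
isClique {n} c x S =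
  and (map (λ i → and (map (λ j →
         not (⌊ i <? j ⌋ ∧ ⌊ i ∈? S ⌋ ∧ ⌊ j ∈? S ⌋) ∨ hasCol (c i j) x)
       (allFin n)))
      (allFin n))

allSubsets : (n : ℕ) → List (Subset n)
allSubsets zero    = [] ∷ []
allSubsets (suc n) = map (true ∷_) (allSubsets n) ++ map (false ∷_) (allSubsets n)

cliqueNumber : {n : ℕ} → Colouring n → Col → ℕ
cliqueNumber {n} c x =
  foldr _⊔_ 0 (map (λ S → if isClique c x S then ∣ S ∣ else 0) (allSubsets n))

-- The (p,q)-biased game.  A turn of q edges is modelled as q consecutive
-- single-edge moves by the same player (equivalent, as the opponent does
-- not move in between).  If the board fills up during a turn, the game
-- ends (the player colours all remaining edges).

data Phase : Set where
  aliceP : ℕ → Phase     -- Alice to move, with this many edges left in her turn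
  bobP   : ℕ → Phase     -- Bob to move, with this many edges left in his turn

afterAlice : ℕ → ℕ → ℕ → Phase   -- p q k : Alice had suc k left
afterAlice p q zero    = bobP q
afterAlice p q (suc k) = aliceP (suc k)

afterBob : ℕ → ℕ → ℕ → Phase
afterBob p q zero    = aliceP p
afterBob p q (suc k) = bobP (suc k)

data BobWins (p q : ℕ) {n : ℕ} : Phase → Colouring n → Set where
  finished  : ∀ {ph c} → Full c →
              cliqueNumber c red < cliqueNumber c blue →
              BobWins p q ph c
  aliceMove : ∀ {k c} → ¬ Full c →
              (∀ i j → Free c i j →
                 BobWins p q (afterAlice p q k) (paint c i j red)) →
              BobWins p q (aliceP (suc k)) c
  bobMove   : ∀ {k c} → ¬ Full c →
              ∀ i j → Free c i j →
              BobWins p q (afterBob p q k) (paint c i j blue) →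
              BobWins p q (bobP (suc k)) c

Player2Wins : ℕ → ℕ → ℕ → Set
Player2Wins p q n = BobWins p q {n} (aliceP p) (empty n)

{-# OPTIONS --safe #-}

-- The vertices are split into a core {u, v, w} and pairs {x, x'}, chosen so that Alice's first edge is
-- ux for one of the pairs. Bob's first turn makes the core a blue triangle. Afterwards he answers an
-- edge between two pairs by taking the other three edges between them, and an edge inside the union of
-- the core and one pair by a winning strategy of the game on these seven edges, found by search; moves
-- he has to spare are harmless. At the end the mates x' of the vertices x of a large red clique R span
-- a blue clique. The local games are chosen so that it can always be enlarged: by a vertex x of R
-- joined in blue to x' or by w, if R misses the core; by two core vertices, or by one together with a
-- vertex of R, if R meets the core (in one vertex). Red cliques of at most three vertices are beaten by
-- the core triangle or by a blue K₄ consisting of core vertices and one pair.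
module Submission where

open import Defs
open import Data.Bool using (Bool; true; false; T; not; if_then_else_; _∧_; _∨_)
open import Data.Bool.Properties using (T-≡; not-involutive; not-¬; ¬-not) renaming (_≟_ to _≟ᵇ_)
open import Data.Fin as Fin using (Fin; zero; suc)
open import Data.Fin.Patterns using (0F; 1F; 2F)
open import Data.Fin.Permutation using (transpose)
import Data.Fin.Permutation.Components as Components
import Data.Fin.Properties as Fin
open import Data.Fin.Subset using (Subset; ⁅_⁆; _∪_; ∣_∣; inside; outside) renaming (⊥ to ∅; _∈_ to _∈ˢ_)
open import Data.Fin.Subset.Properties
  using (_∈?_; x∈⁅x⁆; x∈⁅y⁆⇒x≡y; x∈p∪q⁻; p⊆p∪q; q⊆p∪q; ∉⊥; p⊂q⇒∣p∣<∣q∣)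
open import Data.List using (List; []; _∷_; _++_; length; map; filter; foldr; allFin; cartesianProduct;
  cartesianProductWith)
open import Data.List.Membership.Propositional using (_∈_; find; lose)
open import Data.List.Membership.Propositional.Properties
  using (∈-map⁺; ∈-++⁺ˡ; ∈-++⁺ʳ; ∈-filter⁺; ∈-cartesianProduct⁺; ∈-allFin)
open import Data.List.Properties using (length-map; filter-notAll)
open import Data.List.Relation.Binary.Permutation.Propositional using (_↭_; ↭-refl; ↭-trans; prep; swap; ↭⇒↭ₛ)
open import Data.List.Relation.Binary.Permutation.Propositional.Properties using (↭-length; All-resp-↭)
import Data.List.Relation.Binary.Permutation.Setoid.Properties as Permutation
open import Data.List.Relation.Unary.All as All using (All; []; _∷_)
import Data.List.Relation.Unary.All.Properties as All
open import Data.List.Relation.Unary.AllPairs as AllPairs using (AllPairs; []; _∷_)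
import Data.List.Relation.Unary.AllPairs.Properties as AllPairs
open import Data.List.Relation.Unary.Any as Any using (here; there)
open import Data.Maybe as Maybe using (Maybe; just; nothing; _>>=_; _<∣>_; from-just)
open import Data.Nat using (ℕ; zero; suc; _+_; _*_; _≤_; _<_; _⊔_; z≤n; s≤s; s≤s⁻¹; _%_; _/_)
open import Data.Nat.DivMod using (m≡m%n+[m/n]*n)
open import Data.Nat.Properties
  using (≤-refl; ≤-trans; ≤-reflexive; <-≤-trans; m≤n⇒m≤1+n; n≤1+n; _≤?_; ≰⇒>; ⊔-lub; m≤m⊔n; m≤n⊔m)
open import Data.Product using (∃; ∃₂; _×_; _,_; proj₁; proj₂)
open import Data.Product.Function.NonDependent.Propositional using (_×-↔_)
open import Data.Product.Properties using (≡-dec)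
open import Data.Sum using (_⊎_; inj₁; inj₂)
open import Data.Sum.Function.Propositional using (_⊎-↔_)
open import Data.Vec using ([]; _∷_; here; there)
open import Function using (_∘_; _on_; _↔_; Equivalence; Injection; Inverse; mk↔ₛ′)
open import Function.Construct.Composition using (_↔-∘_)
open import Function.Construct.Identity using (↔-id)
open import Function.Construct.Symmetry using (↔-sym)
open import Function.Properties.Inverse using (↔⇒↣)
open import Relation.Binary using (tri<; tri≈; tri>)
open import Relation.Binary.PropositionalEquality
  using (_≡_; _≢_; refl; sym; trans; cong; cong₂; subst; subst₂; setoid; resp₂)
open import Relation.Nullary using (¬_; Dec; yes; no; contradiction)
open import Relation.Nullary.Decidable
  using (⌊_⌋; dec⇒maybe; decidable-stable; map′; ¬?; _×-dec_; _⊎-dec_; _→-dec_)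

-- Turns and spare moves

SameEdge : {A : Set} → A → A → A → A → Set
SameEdge a b x y = (x ≡ a × y ≡ b) ⊎ (x ≡ b × y ≡ a)

infix 4 _≼_

-- The possible effect of Bob's moves, wanted or spare, on a single edge.
data _≼_ : Maybe Col → Maybe Col → Set where
  keep : ∀ {x} → x ≼ x
  fill : nothing ≼ just blue

≼-trans : ∀ {x y z} → x ≼ y → y ≼ z → x ≼ z
≼-trans keep q    = q
≼-trans fill keep = fill

≼-nothing : ∀ {x} → x ≼ nothing → x ≡ nothing
≼-nothing keep = refl

just-≼ : ∀ {x y} → just x ≼ y → y ≡ just x
just-≼ keep = refl

≼-red : ∀ {x} → x ≼ just red → x ≡ just red
≼-red keep = refl

Symmetric Irreflexive : {A : Set} → (A → A → Maybe Col) → Set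
Symmetric   c = ∀ u v → c u v ≡ c v u
Irreflexive c = ∀ u → c u u ≡ nothing

module _ {n : ℕ} where

  paint-hit : ∀ (c : Colouring n) i j x {u v} → SameEdge i j u v → paint c i j x u v ≡ just x
  paint-hit c i j x {u} {v} h with u Fin.≟ i | v Fin.≟ j | u Fin.≟ j | v Fin.≟ i | h
  ... | yes _ | yes _ | _ | _ | _ = refl
  ... | yes _ | no _ | yes _ | yes _ | _ = refl
  ... | no _ | _ | yes _ | yes _ | _ = refl
  ... | no p | _ | _ | _ | inj₁ (e , _) = contradiction e p
  ... | _ | no p | _ | _ | inj₁ (_ , e) = contradiction e p
  ... | _ | _ | no p | _ | inj₂ (e , _) = contradiction e p
  ... | _ | _ | _ | no p | inj₂ (_ , e) = contradiction e p

  paint-miss : ∀ (c : Colouring n) i j x {u v} → ¬ SameEdge i j u v → paint c i j x u v ≡ c u v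
  paint-miss c i j x {u} {v} h with u Fin.≟ i | v Fin.≟ j | u Fin.≟ j | v Fin.≟ i
  ... | yes p | yes q | _ | _ = contradiction (inj₁ (p , q)) h
  ... | yes _ | no _ | yes p | yes q = contradiction (inj₂ (p , q)) h
  ... | no _ | _ | yes p | yes q = contradiction (inj₂ (p , q)) h
  ... | yes _ | no _ | yes _ | no _ = refl
  ... | yes _ | no _ | no _ | _ = refl
  ... | no _ | _ | yes _ | no _ = refl
  ... | no _ | _ | no _ | _ = refl

  sameEdge? : ∀ (i j u v : Fin n) → Dec (SameEdge i j u v)
  sameEdge? i j u v = (u Fin.≟ i ×-dec v Fin.≟ j) ⊎-dec (u Fin.≟ j ×-dec v Fin.≟ i)

  same-swap : ∀ {A : Set} {a b x y : A} → SameEdge a b x y → SameEdge a b y x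
  same-swap (inj₁ (p , q)) = inj₂ (q , p)
  same-swap (inj₂ (p , q)) = inj₁ (q , p)

  paint-symmetric : ∀ {c : Colouring n} i j x → Symmetric c → Symmetric (paint c i j x)
  paint-symmetric {c} i j x c-sym u v with sameEdge? i j u v
  ... | yes h = trans (paint-hit c i j x h) (sym (paint-hit c i j x (same-swap h)))
  ... | no ¬h = trans (paint-miss c i j x ¬h)
                      (trans (c-sym u v) (sym (paint-miss c i j x λ h → ¬h (same-swap h))))

  paint-irreflexive : ∀ (c : Colouring n) {i j} x → i ≢ j → Irreflexive c → Irreflexive (paint c i j x)
  paint-irreflexive c {i} {j} x i≢j c-irr u = trans (paint-miss c i j x λ
    { (inj₁ (p , q)) → i≢j (trans (sym p) q) ; (inj₂ (p , q)) → i≢j (trans (sym q) p) }) (c-irr u)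

  infix 4 _⊑_

  -- The pointwise order alone does not carry symmetry and irreflexivity upwards, so both are
  -- included as implications, which `paint` can supply.
  record _⊑_ (c c′ : Colouring n) : Set where
    field
      pointwise   : ∀ u v → c u v ≼ c′ u v
      symmetric   : Symmetric c → Symmetric c′
      irreflexive : Irreflexive c → Irreflexive c′

  open _⊑_ public

  ⊑-refl : ∀ {c} → c ⊑ c
  ⊑-refl = record { pointwise = λ _ _ → keep ; symmetric = λ s → s ; irreflexive = λ i → i }

  ⊑-trans : ∀ {a b c} → a ⊑ b → b ⊑ c → a ⊑ c
  ⊑-trans p q = record
    { pointwise   = λ u v → ≼-trans (pointwise p u v) (pointwise q u v)
    ; symmetric   = λ s → symmetric q (symmetric p s)
    ; irreflexive = λ i → irreflexive q (irreflexive p i)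
    }

  ⊑-paint : ∀ {c : Colouring n} {i j} → Symmetric c → Free c i j → c ⊑ paint c i j blue
  ⊑-paint {c} {i} {j} c-sym (i<j , vacant) = record
    { pointwise   = step
    ; symmetric   = paint-symmetric i j blue
    ; irreflexive = paint-irreflexive c blue (Fin.<⇒≢ i<j)
    }
    where
    hit : ∀ {u v} → SameEdge i j u v → c u v ≡ nothing
    hit (inj₁ (refl , refl)) = vacant
    hit (inj₂ (refl , refl)) = trans (c-sym j i) vacant
    step : ∀ u v → c u v ≼ paint c i j blue u v
    step u v with sameEdge? i j u v
    ... | no ¬h rewrite paint-miss c i j blue ¬h = keep
    ... | yes h rewrite paint-hit c i j blue h | hit h = fill

  free? : ∀ (c : Colouring n) i j → Dec (Free c i j)
  free? c i j = (i Fin.<? j) ×-dec nothing? (c i j)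
    where
    nothing? : (x : Maybe Col) → Dec (x ≡ nothing)
    nothing? nothing  = yes refl
    nothing? (just _) = no λ ()

  full-or-free : ∀ (c : Colouring n) → Full c ⊎ ∃₂ (Free c)
  full-or-free c with Fin.any? (λ i → Fin.any? (free? c i))
  ... | yes (i , j , f) = inj₂ (i , j , f)
  ... | no ¬f = inj₁ λ i j i<j e → ¬f (i , j , i<j , e)

  Blue : Colouring n → Fin n × Fin n → Set
  Blue c (u , v) = c u v ≡ just blue

  Available : Colouring n → Fin n × Fin n → Set
  Available c (u , v) = u ≢ v × c u v ≢ just red

  available-paint : ∀ (c : Colouring n) i j {e} → Available c e → Available (paint c i j blue) e
  available-paint c i j {u , v} (u≢v , not-red) = u≢v , still
    where
    still : paint c i j blue u v ≢ just red
    still with sameEdge? i j u v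
    ... | yes h = λ e → contradiction (trans (sym (paint-hit c i j blue h)) e) λ ()
    ... | no ¬h = λ e → not-red (trans (sym (paint-miss c i j blue ¬h)) e)

  painted : ∀ {c c′ : Colouring n} {i j x u v} → paint c i j x ⊑ c′ → SameEdge i j u v → c′ u v ≡ just x
  painted {c} {c′} {i} {j} {x} {u} {v} p h =
    just-≼ (subst (_≼ c′ u v) (paint-hit c i j x h) (pointwise p u v))

  -- The length of such a list bounds the number of moves still to come. It may contain coloured
  -- edges as well; each move shortens it by `without`.
  FreeIn : List (Fin n × Fin n) → Colouring n → Set
  FreeIn es c = ∀ i j → Free c i j → (i , j) ∈ es

  without : Fin n → Fin n → List (Fin n × Fin n) → List (Fin n × Fin n)
  without i j = filter λ e → ¬? (≡-dec Fin._≟_ Fin._≟_ e (i , j))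

  without-shrinks : ∀ {i j es} → (i , j) ∈ es → length (without i j es) < length es
  without-shrinks {es = es} ij∈es = filter-notAll _ es (lose ij∈es λ ¬p → ¬p refl)

  without-free : ∀ {es c i j} x → FreeIn es c → FreeIn (without i j es) (paint c i j x)
  without-free {c = c} {i} {j} x cov u v (u<v , e) with sameEdge? i j u v
  ... | yes h = contradiction (trans (sym (paint-hit c i j x h)) e) λ ()
  ... | no ¬h = ∈-filter⁺ _ (cov u v (u<v , trans (sym (paint-miss c i j x ¬h)) e))
                            λ { refl → ¬h (inj₁ (refl , refl)) }

  -- Spare moves are harmless as long as the invariant only needs some edges to become blue.
  record Strategy (q : ℕ) (I : Colouring n → Set) : Set where
    field
      sym-I : ∀ {c} → I c → Symmetric c
      final : ∀ {c} → I c → Full c → cliqueNumber c red < cliqueNumber c blue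
      reply : ∀ {c} → I c → ∀ {i j} → Free c i j → let c₁ = paint c i j red in
              ∃ λ es → length es ≤ suc q × All (Available c₁) es ×
                       (∀ {c′} → c₁ ⊑ c′ → All (Blue c′) es → I c′)

  module _ {q : ℕ} {I : Colouring n → Set} (σ : Strategy q I) where
    open Strategy σ

    -- Mutual induction on `N`, and within a turn on `ds`, the edges that Bob still owes. The
    -- continuation restores the invariant on every extension of the present board in which the owed
    -- edges are blue.
    alice : ∀ N {c es} → FreeIn es c → length es ≤ N → I c → BobWins 1 (suc q) (aliceP 1) c
    bob   : ∀ N k {c es} → FreeIn es c → length es ≤ N → Symmetric c →
            ∀ ds → length ds ≤ suc k → All (Available c) ds →
            (∀ {c′} → c ⊑ c′ → All (Blue c′) ds → I c′) →
            BobWins 1 (suc q) (bobP (suc k)) c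

    bob-paints : ∀ N k {c es i j} → FreeIn es c → length es ≤ N → Symmetric c → Free c i j →
                 ∀ ds → length ds ≤ k → All (Available (paint c i j blue)) ds →
                 (∀ {c′} → paint c i j blue ⊑ c′ → All (Blue c′) ds → I c′) →
                 BobWins 1 (suc q) (bobP (suc k)) c

    alice N {c} cov len inv with full-or-free c
    ... | inj₁ full = finished full (final inv full)
    alice zero {es = []} cov len inv | inj₂ (i , j , f) with () ← cov i j f
    alice (suc N) {c} {es} cov len inv | inj₂ (i , j , f) =
      aliceMove (λ full → full i j (proj₁ f) (proj₂ f)) λ u v g →
        let ds , l , av , k = reply inv g
        in bob N q (without-free red cov)
               (shorter (cov u v g) len)
               (paint-symmetric u v red (sym-I inv)) ds l av k
      where
      shorter : ∀ {u v} → (u , v) ∈ es → length es ≤ suc N → length (without u v es) ≤ N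
      shorter uv∈ l with ≤-trans (without-shrinks uv∈) l
      ... | s≤s l′ = l′

    bob-paints zero k {es = []} cov len c-sym f with () ← cov _ _ f
    bob-paints (suc N) k {c} {es} {i} {j} cov len c-sym f ds l av cont =
      bobMove (λ full → full i j (proj₁ f) (proj₂ f)) i j f (rest k l)
      where
      shorter : length (without i j es) ≤ N
      shorter with ≤-trans (without-shrinks (cov i j f)) len
      ... | s≤s l′ = l′
      rest : ∀ k → length ds ≤ k → BobWins 1 (suc q) (afterBob 1 (suc q) k) (paint c i j blue)
      rest zero l₀ = alice N (without-free blue cov) shorter (cont ⊑-refl (none ds l₀))
        where
        none : ∀ ds → length ds ≤ 0 → All (Blue (paint c i j blue)) ds
        none [] _ = []
      rest (suc k) l₁ = bob N k (without-free blue cov) shorter (paint-symmetric i j blue c-sym) ds l₁ av cont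

    bob N k {c} cov len c-sym [] l [] cont with full-or-free c
    ... | inj₁ full = finished full (final (cont ⊑-refl []) full)
    -- Nothing is owed any more, so any free edge will do: the continuation only asks for an
    -- extension of `c`.
    ... | inj₂ (i , j , f) = bob-paints N k cov len c-sym f [] z≤n []
                               (λ c⊑c′ → cont (⊑-trans (⊑-paint c-sym f) c⊑c′))
    bob N k {c} cov len c-sym ((u , v) ∷ ds) (s≤s l) ((u≢v , not-red) ∷ av) cont with c u v in eq
    ... | just red  = contradiction refl not-red
    -- An owed edge that is blue already costs no move, so the turn gains a spare one.
    ... | just blue = bob N k cov len c-sym ds (m≤n⇒m≤1+n l) av λ c⊑c′ bs →
                        cont c⊑c′ (just-≼ (subst (_≼ _) eq (pointwise c⊑c′ u v)) ∷ bs)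
    ... | nothing with Fin.<-cmp u v
    ...   | tri≈ _ u≡v _ = contradiction u≡v u≢v
    ...   | tri< u<v _ _ = bob-paints N k cov len c-sym (u<v , eq) ds l (All.map (available-paint c u v) av)
                             λ c⊑c′ bs → cont (⊑-trans (⊑-paint c-sym (u<v , eq)) c⊑c′)
                               (painted c⊑c′ (inj₁ (refl , refl)) ∷ bs)
    ...   | tri> _ _ v<u = bob-paints N k cov len c-sym f ds l (All.map (available-paint c v u) av)
                             λ c⊑c′ bs → cont (⊑-trans (⊑-paint c-sym f) c⊑c′)
                               (painted c⊑c′ (inj₂ (refl , refl)) ∷ bs)
      where f = v<u , trans (c-sym v u) eq

-- The game on the core and one pair

-- spoke k b joins core vertex k to side b of the pair, and the rung joins the two sides.
data Slot : Set where
  spoke : Fin 3 → Bool → Slot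
  rung  : Slot

slots : List Slot
slots = rung ∷ cartesianProductWith spoke (allFin 3) (false ∷ true ∷ [])

∈-slots : ∀ e → e ∈ slots
∈-slots rung             = here refl
∈-slots (spoke 0F false) = there (here refl)
∈-slots (spoke 0F true)  = there (there (here refl))
∈-slots (spoke 1F false) = there (there (there (here refl)))
∈-slots (spoke 1F true)  = there (there (there (there (here refl))))
∈-slots (spoke 2F false) = there (there (there (there (there (here refl)))))
∈-slots (spoke 2F true)  = there (there (there (there (there (there (here refl))))))

_≟ˢ_ : (e f : Slot) → Dec (e ≡ f)
rung      ≟ˢ rung      = yes refl
rung      ≟ˢ spoke _ _ = no λ ()
spoke _ _ ≟ˢ rung      = no λ ()
spoke k b ≟ˢ spoke l c = map′ (λ { (refl , refl) → refl }) (λ { refl → refl , refl })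
                              (k Fin.≟ l ×-dec b ≟ᵇ c)

Position : Set
Position = Slot → Maybe Col

put : Col → Slot → Position → Position
put x e s f = if ⌊ e ≟ˢ f ⌋ then just x else s f

put-same : ∀ x e s → put x e s e ≡ just x
put-same x e s with e ≟ˢ e
... | yes _  = refl
... | no e≢e with () ← e≢e refl

put-other : ∀ x {e f} s → e ≢ f → put x e s f ≡ s f
put-other x {e} {f} s e≢f with e ≟ˢ f
... | yes e≡f with () ← e≢f e≡f
... | no _ = refl

putAll : Col → List Slot → Position → Position
putAll x es s = foldr (put x) s es

Red Vacant : Position → Slot → Set
Red    s e = s e ≡ just red
Vacant s e = s e ≡ nothing

-- `Good` is required after each of Bob's replies and not only when all slots are taken, since Alice
-- may stop playing in the pair at any stage.
data Survives (Good : Position → Set) (s : Position) : Set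

Response : (Position → Set) → Position → Set
Response Good s = ∃ λ es → length es ≤ 3 × All (Vacant s) es × Survives Good (putAll blue es s)

data Survives Good s where
  survives : Good s → (∀ e → Vacant s e → Response Good (put red e s)) → Survives Good s

good : ∀ {Good s} → Survives Good s → Good s
good (survives g _) = g

-- Exhaustive search for local strategies

vacant? : ∀ s e → Dec (Vacant s e)
vacant? s e with s e
... | nothing = yes refl
... | just _  = no λ ()

-- All sublists of length k, and some shorter ones for the case that fewer than k entries are left.
choose : {A : Set} → ℕ → List A → List (List A)
choose zero    _        = [] ∷ []
choose (suc _) []       = [] ∷ []
choose (suc k) (x ∷ []) = (x ∷ []) ∷ []
choose (suc k) (x ∷ xs@(_ ∷ _)) = map (x ∷_) (choose k xs) ++ choose (suc k) xs

allJust : {A : Set} {P : A → Set} → (∀ x → Maybe (P x)) → ∀ xs → Maybe (All P xs)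
allJust f []       = just []
allJust f (x ∷ xs) = do
  p  ← f x
  ps ← allJust f xs
  just (p ∷ ps)

firstJust : {A : Set} {P : A → Set} → (∀ x → Maybe (P x)) → List A → Maybe (∃ P)
firstJust f []       = nothing
firstJust f (x ∷ xs) = Maybe.map (x ,_) (f x) <∣> firstJust f xs

module _ {Good : Position → Set} (Good? : ∀ s → Dec (Good s)) where

  search  : ℕ → ∀ s → Maybe (Survives Good s)
  respond : ℕ → ∀ s e → Maybe (Vacant s e → Response Good (put red e s))
  answer  : ℕ → ∀ s es → Maybe (length es ≤ 3 × All (Vacant s) es × Survives Good (putAll blue es s))

  search zero    s = nothing
  search (suc f) s = do
    g  ← dec⇒maybe (Good? s)
    rs ← allJust (respond f s) slots
    just (survives g λ e → All.lookup rs (∈-slots e))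

  respond f s e with vacant? s e
  ... | no ¬v = just λ v → contradiction v ¬v
  ... | yes _ = Maybe.map (λ r _ → r) (firstJust (answer f s′) (choose 3 (filter (vacant? s′) slots)))
    where s′ = put red e s

  answer f s es = do
    l  ← dec⇒maybe (length es ≤? 3)
    vs ← dec⇒maybe (All.all? (vacant? s) es)
    w  ← search f (putAll blue es s)
    just (l , vs , w)

-- Vacant slots count as clear: if Alice never takes them, they end up blue.
Clear : Position → Slot → Set
Clear s e = ¬ Red s e

-- Used with `b` the mate of a side joined in red to core vertex `k`: the other two core vertices
-- can then be added to the mates of a red clique through `k`.
Backed : Position → Fin 3 → Bool → Set
Backed s k b = ∀ t → t ≢ k → Clear s (spoke t b)

-- Either way the core and the pair contain a blue K₄.
Quad : Position → Set
Quad s = (∃ λ b → ∀ t → Clear s (spoke t b)) ⊎ (Clear s rung × ∃ λ k → ∀ b → Backed s k b)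

Triangle : Position → Set
Triangle s = Red s rung × ∃ λ k → ∀ b → Red s (spoke k b)

-- Serves red cliques that avoid the core and have all their rungs red. One core vertex must be blue
-- to the mates from every pair at once, hence the fixed index `2F`.
Anchored : Position → Set
Anchored s = Red s rung → ∀ b → Clear s (spoke 2F b)

-- `Strict` is for pairs untouched by the opening. The alternative in `Lax` offers one other core
-- vertex together with the clique's own vertex in the pair, whose rung is then blue. `Small` deals
-- with the only shape of a red clique on three vertices when there is a single pair.
Strict Lax Small : Position → Set
Strict s = (∀ k b → Red s (spoke k b) → Backed s k (not b)) × Anchored s × Quad s
Lax s = (∀ k b → Red s (spoke k b) → Backed s k (not b) ⊎
                 (Clear s rung × ∃ λ t → t ≢ k × ∀ c → Clear s (spoke t c))) × Anchored s
Small s = Quad s ⊎ ¬ Triangle s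

red? : ∀ s e → Dec (Red s e)
red? s e with s e
... | nothing   = no λ ()
... | just red  = yes refl
... | just blue = no λ ()

∀ᵇ? : {P : Bool → Set} → (∀ b → Dec (P b)) → Dec (∀ b → P b)
∀ᵇ? P? = map′ (λ { (f , t) false → f ; (f , t) true → t }) (λ h → h false , h true)
              (P? false ×-dec P? true)

∃ᵇ? : {P : Bool → Set} → (∀ b → Dec (P b)) → Dec (∃ P)
∃ᵇ? P? = map′ (λ { (inj₁ p) → false , p ; (inj₂ p) → true , p })
              (λ { (false , p) → inj₁ p ; (true , p) → inj₂ p })
              (P? false ⊎-dec P? true)

clear? : ∀ s e → Dec (Clear s e)
clear? s e = ¬? (red? s e)

backed? : ∀ s k b → Dec (Backed s k b)
backed? s k b = Fin.all? λ t → ¬? (t Fin.≟ k) →-dec clear? s (spoke t b)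

quad? : ∀ s → Dec (Quad s)
quad? s = ∃ᵇ? (λ b → Fin.all? λ t → clear? s (spoke t b)) ⊎-dec
          (clear? s rung ×-dec Fin.any? λ k → ∀ᵇ? (backed? s k))

anchored? : ∀ s → Dec (Anchored s)
anchored? s = red? s rung →-dec ∀ᵇ? λ b → clear? s (spoke 2F b)

strict? : ∀ s → Dec (Strict s)
strict? s = (Fin.all? λ k → ∀ᵇ? λ b → red? s (spoke k b) →-dec backed? s k (not b))
            ×-dec anchored? s ×-dec quad? s

lax? : ∀ s → Dec (Lax s)
lax? s = (Fin.all? λ k → ∀ᵇ? λ b → red? s (spoke k b) →-dec
           (backed? s k (not b) ⊎-dec
            (clear? s rung ×-dec
             Fin.any? λ t → ¬? (t Fin.≟ k) ×-dec ∀ᵇ? λ c → clear? s (spoke t c))))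
         ×-dec anchored? s

small? : ∀ s → Dec (Small s)
small? s = quad? s ⊎-dec
           ¬? (red? s rung ×-dec Fin.any? λ k → ∀ᵇ? λ b → red? s (spoke k b))

vacant opened : Position
vacant _ = nothing
opened   = put red (spoke 0F false) vacant

-- The fuel `3` covers the initial position and those after two rounds: if Bob takes three slots
-- first and then all that are left, two rounds exhaust the seven slots, and likewise the six vacant
-- ones of `opened`.
strict-survives : Survives Strict vacant
strict-survives = from-just (search strict? 3 vacant)

lax-survives : Survives Lax opened
lax-survives = from-just (search lax? 3 opened)

small-survives : Survives Small opened
small-survives = from-just (search small? 3 opened)

-- Bob's answers on the whole board

data Vertex (m : ℕ) : Set where
  core : Fin 3 → Vertex m
  limb : Fin m → Bool → Vertex m

module _ {m : ℕ} where

  _≟ᵛ_ : (x y : Vertex m) → Dec (x ≡ y)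
  core k   ≟ᵛ core l   = map′ (λ { refl → refl }) (λ { refl → refl }) (k Fin.≟ l)
  core _   ≟ᵛ limb _ _ = no λ ()
  limb _ _ ≟ᵛ core _   = no λ ()
  limb i b ≟ᵛ limb j c = map′ (λ { (refl , refl) → refl }) (λ { refl → refl , refl })
                              (i Fin.≟ j ×-dec b ≟ᵇ c)

  limb-side : ∀ {i j b c} → limb {m} i b ≡ limb j c → b ≡ c
  limb-side refl = refl

  ends : Fin m → Slot → Vertex m × Vertex m
  ends i (spoke k b) = core k , limb i b
  ends i rung        = limb i false , limb i true

  Table : Set
  Table = Vertex m → Vertex m → Maybe Col

  infix 8 _at_

  _at_ : Table → Vertex m × Vertex m → Maybe Col
  d at (x , y) = d x y

  SameEdge₂ : Vertex m × Vertex m → Vertex m × Vertex m → Set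
  SameEdge₂ (a , b) (x , y) = SameEdge a b x y

  ends-injective : ∀ {i j} e f → SameEdge₂ (ends i e) (ends j f) → i ≡ j × e ≡ f
  ends-injective (spoke _ _) (spoke _ _) (inj₁ (refl , refl)) = refl , refl
  ends-injective rung        rung        (inj₁ (refl , refl)) = refl , refl
  ends-injective (spoke _ _) (spoke _ _) (inj₂ (() , _))
  ends-injective (spoke _ _) rung        (inj₂ (_ , ()))
  ends-injective rung        (spoke _ _) (inj₂ (() , _))
  ends-injective rung        rung        (inj₂ (() , _))

  ends-distinct : ∀ i e → proj₁ (ends i e) ≢ proj₂ (ends i e)
  ends-distinct i (spoke _ _) ()
  ends-distinct i rung        ()

  -- The board may be ahead of the recorded position, but only by blue edges. Spare moves therefore
  -- need no record, and a slot that Alice can still take is vacant in the position too.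
  Extends : Position → Table → Fin m → Set
  Extends s d i = ∀ e → s e ≼ d at ends i e

  OthersBlue : Table → Fin m → Bool → Fin m → Bool → Set
  OthersBlue d i b j c = d (limb i (not b)) (limb j c) ≡ just blue ×
                         d (limb i b) (limb j (not c)) ≡ just blue ×
                         d (limb i (not b)) (limb j (not c)) ≡ just blue

  record Invariant (Good : Fin m → Position → Set) (d : Table) : Set where
    field
      core-blue : ∀ {k l} → k ≢ l → d (core k) (core l) ≡ just blue
      cross     : ∀ {i j} b c → i ≢ j → d (limb i b) (limb j c) ≡ just red → OthersBlue d i b j c
      pairs     : ∀ i → ∃ λ s → Survives (Good i) s × Extends s d i

  -- Describes Alice's edge and Bob's whole turn at once, spare moves included, without reference to
  -- `paint` or to labels.
  record Round (d : Table) (e : Vertex m × Vertex m) (d′ : Table) : Set where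
    field
      symmetric : Symmetric d′
      hit       : d′ at e ≡ just red
      miss      : ∀ f → ¬ SameEdge₂ e f → d at f ≼ d′ at f

  Answerable : Table → Vertex m × Vertex m → Vertex m × Vertex m → Set
  Answerable d e f = proj₁ f ≢ proj₂ f × d at f ≢ just red × ¬ SameEdge₂ e f

  Blueᵀ : Table → Vertex m × Vertex m → Set
  Blueᵀ d f = d at f ≡ just blue

  putAll-case : ∀ x es (s : Position) f → (f ∈ es × putAll x es s f ≡ just x) ⊎ putAll x es s f ≡ s f
  putAll-case x []       s f = inj₂ refl
  putAll-case x (e ∷ es) s f with e ≟ˢ f
  ... | yes refl = inj₁ (here refl , refl)
  ... | no _ with putAll-case x es s f
  ...   | inj₁ (f∈es , p) = inj₁ (there f∈es , p)
  ...   | inj₂ p          = inj₂ p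

  module _ {Good : Fin m → Position → Set} {d : Table} (d-sym : Symmetric d) (inv : Invariant Good d) where
    open Invariant inv

    Reply : Vertex m × Vertex m → Set
    Reply e = ∃ λ fs → length fs ≤ 3 × All (Answerable d e) fs ×
                       (∀ {d′} → Round d e d′ → All (Blueᵀ d′) fs → Invariant Good d′)

    blue-stays : ∀ {e d′} f → d at e ≡ nothing → Round d e d′ → d at f ≡ just blue → d′ at f ≡ just blue
    blue-stays {e} {d′} f vacant r p = just-≼ (subst (_≼ d′ at f) p (Round.miss r f ¬same))
      where
      ¬same : ¬ SameEdge₂ e f
      ¬same (inj₁ (refl , refl)) = contradiction (trans (sym vacant) p) λ ()
      ¬same (inj₂ (refl , refl)) = contradiction (trans (sym vacant) (trans (d-sym _ _) p)) λ ()

    others-stay : ∀ {e d′ i b j c} → d at e ≡ nothing → Round d e d′ → OthersBlue d i b j c → OthersBlue d′ i b j c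
    others-stay v r (p , q , s) = blue-stays (_ , _) v r p , blue-stays (_ , _) v r q , blue-stays (_ , _) v r s

    red-was : ∀ {e d′ f} → Round d e d′ → ¬ SameEdge₂ e f → d′ at f ≡ just red → d at f ≡ just red
    red-was {f = f} r ¬same p = ≼-red (subst (d at f ≼_) p (Round.miss r f ¬same))

    -- The slot is vacant in the recorded position as well, so the local strategy has an answer
    -- there. Its edges may already be blue on the board but cannot be red. Cross edges and other
    -- pairs gain at most blue edges.
    reply-pair : ∀ i e → d at ends i e ≡ nothing → Reply (ends i e)
    reply-pair i e vacant with pairs i
    ... | s , survives _ respond , ext with respond e (≼-nothing (subst (s e ≼_) vacant (ext e)))
    ... | es , len , free , next =
      map (ends i) es , ≤-trans (≤-reflexive (length-map _ es)) len ,
      All.map⁺ (All.map answerable free) , after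
      where
      answerable : ∀ {f} → Vacant (put red e s) f → Answerable d (ends i e) (ends i f)
      answerable {f} v = ends-distinct i f , not-red , λ h → f≢e (proj₂ (ends-injective e f h))
        where
        f≢e : e ≢ f
        f≢e refl = contradiction (trans (sym v) (put-same red e s)) λ ()
        not-red : d at ends i f ≢ just red
        not-red p with subst₂ _≼_ (trans (sym (put-other red s f≢e)) v) p (ext f)
        ... | ()
      after : ∀ {d′} → Round d (ends i e) d′ → All (Blueᵀ d′) (map (ends i) es) → Invariant Good d′
      after {d′} r blues = record
        { core-blue = λ k≢l → blue-stays (_ , _) vacant r (core-blue k≢l)
        ; cross     = λ b c j≢l p → others-stay vacant r (cross b c j≢l (red-was r (cross-edge e j≢l) p))
        ; pairs     = pairs′
        }
        where
        cross-edge : ∀ e {j l b c} → j ≢ l → ¬ SameEdge₂ (ends i e) (limb j b , limb l c)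
        cross-edge rung        j≢l (inj₁ (refl , refl)) = j≢l refl
        cross-edge rung        j≢l (inj₂ (refl , refl)) = j≢l refl
        pairs′ : ∀ j → ∃ λ s → Survives (Good j) s × Extends s d′ j
        pairs′ j with i Fin.≟ j
        ... | no i≢j = let s , w , ext = pairs j in
              s , w , λ f → ≼-trans (ext f) (Round.miss r (ends j f) λ h → i≢j (proj₁ (ends-injective e f h)))
        ... | yes refl = _ , next , ext′
          where
          ext′ : Extends (putAll blue es (put red e s)) d′ i
          ext′ f with putAll-case blue es (put red e s) f
          ... | inj₁ (f∈es , p) rewrite p | All.lookup (All.map⁻ blues) f∈es = keep
          ... | inj₂ p rewrite p with e ≟ˢ f
          ...   | yes refl rewrite Round.hit r = keep
          ...   | no e≢f = ≼-trans (ext f) (Round.miss r (ends i f) λ h → e≢f (proj₂ (ends-injective e f h)))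

    -- None of the other three edges between the two pairs is red, because `cross` would then have
    -- made Alice's new edge blue before she took it.
    reply-cross : ∀ i b j c → i ≢ j → d (limb i b) (limb j c) ≡ nothing → Reply (limb i b , limb j c)
    reply-cross i b j c i≢j vacant =
      ((limb i (not b) , limb j c) ∷ (limb i b , limb j (not c)) ∷ (limb i (not b) , limb j (not c)) ∷ []) ,
      s≤s (s≤s (s≤s z≤n)) ,
      (distinct , not-red₁ , λ { (inj₁ (p , _)) → b-moved p ; (inj₂ (p , _)) → distinct p }) ∷
      (distinct , not-red₂ , λ { (inj₁ (_ , p)) → c-moved p ; (inj₂ (p , _)) → distinct p }) ∷
      (distinct , not-red₃ , λ { (inj₁ (p , _)) → b-moved p ; (inj₂ (p , _)) → distinct p }) ∷ [] ,
      after
      where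
      distinct : ∀ {b′ c′} → limb i b′ ≢ limb j c′
      distinct refl = i≢j refl
      b-moved : limb i (not b) ≢ limb i b
      b-moved p = not-¬ refl (sym (limb-side p))
      c-moved : limb j (not c) ≢ limb j c
      c-moved p = not-¬ refl (sym (limb-side p))
      impossible : ∀ {b′ c′} → b′ ≡ b → c′ ≡ c → d (limb i b′) (limb j c′) ≢ just blue
      impossible refl refl p = contradiction (trans (sym vacant) p) λ ()
      not-red₁ : d (limb i (not b)) (limb j c) ≢ just red
      not-red₁ p = impossible (not-involutive b) refl (proj₁ (cross _ _ i≢j p))
      not-red₂ : d (limb i b) (limb j (not c)) ≢ just red
      not-red₂ p = impossible refl (not-involutive c) (proj₁ (proj₂ (cross _ _ i≢j p)))
      not-red₃ : d (limb i (not b)) (limb j (not c)) ≢ just red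
      not-red₃ p = impossible (not-involutive b) (not-involutive c) (proj₂ (proj₂ (cross _ _ i≢j p)))
      after : ∀ {d′} → Round d (limb i b , limb j c) d′ → All (Blueᵀ d′) _ → Invariant Good d′
      after {d′} r (q₁ ∷ q₂ ∷ q₃ ∷ []) = record
        { core-blue = λ k≢l → blue-stays (_ , _) vacant r (core-blue k≢l)
        ; cross     = cross′
        ; pairs     = λ l → let s , w , ext = pairs l in
            s , w , λ f → ≼-trans (ext f) (Round.miss r (ends l f) (not-slot f))
        }
        where
        not-slot : ∀ {l} f → ¬ SameEdge₂ (limb i b , limb j c) (ends l f)
        not-slot rung (inj₁ (refl , refl)) = i≢j refl
        not-slot rung (inj₂ (refl , refl)) = i≢j refl
        cross′ : ∀ {k l} b′ c′ → k ≢ l → d′ (limb k b′) (limb l c′) ≡ just red → OthersBlue d′ k b′ l c′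
        cross′ {k} {l} b′ c′ k≢l p
          with (limb k b′ ≟ᵛ limb i b ×-dec limb l c′ ≟ᵛ limb j c) ⊎-dec
               (limb k b′ ≟ᵛ limb j c ×-dec limb l c′ ≟ᵛ limb i b)
        ... | yes (inj₁ (refl , refl)) = q₁ , q₂ , q₃
        ... | yes (inj₂ (refl , refl)) =
              -- Read from the other end, Alice's edge exchanges the roles of the first two answers.
              trans (Round.symmetric r _ _) q₂ , trans (Round.symmetric r _ _) q₁ , trans (Round.symmetric r _ _) q₃
        ... | no ¬same = others-stay vacant r (cross b′ c′ k≢l (red-was r ¬same p))

    reply-flip : ∀ {x y} → Reply (x , y) → Reply (y , x)
    reply-flip (fs , len , ok , after) =
      fs , len , All.map (λ (p , q , h) → p , q , λ g → h (flip g)) ok ,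
      λ r → after record
        { symmetric = Round.symmetric r
        ; hit       = trans (Round.symmetric r _ _) (Round.hit r)
        ; miss      = λ f h → Round.miss r f λ g → h (flip g)
        }
      where
      flip : ∀ {a b f} → SameEdge₂ (a , b) f → SameEdge₂ (b , a) f
      flip (inj₁ h) = inj₂ h
      flip (inj₂ h) = inj₁ h

    reply-any : ∀ x y → x ≢ y → d x y ≡ nothing → Reply (x , y)
    reply-any (core k) (core l) x≢y v =
      contradiction (trans (sym v) (core-blue λ { refl → x≢y refl })) λ ()
    reply-any (core k) (limb i b) _ v = reply-pair i (spoke k b) v
    reply-any (limb i b) (core k) _ v = reply-flip (reply-pair i (spoke k b) (trans (d-sym _ _) v))
    reply-any (limb i b) (limb j c) x≢y v with i Fin.≟ j
    ... | no i≢j = reply-cross i b j c i≢j v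
    reply-any (limb i false) (limb i false) x≢y v | yes refl = contradiction refl x≢y
    reply-any (limb i false) (limb i true)  x≢y v | yes refl = reply-pair i rung v
    reply-any (limb i true)  (limb i false) x≢y v | yes refl = reply-flip (reply-pair i rung (trans (d-sym _ _) v))
    reply-any (limb i true)  (limb i true)  x≢y v | yes refl = contradiction refl x≢y

-- Red cliques at the end of the game

-- Pair 0 contains Alice's first edge, so Bob can only reach weaker goals there. If it is the only pair,
-- there is no strict pair to provide a blue K₄.
Goal : ∀ m → Fin m → Position → Set
Goal 1             _       = Small
Goal (suc (suc m)) zero    = Lax
Goal (suc (suc m)) (suc _) = Strict

others : Fin 3 → Fin 3 × Fin 3
others 0F = 1F , 2F
others 1F = 0F , 2F
others 2F = 0F , 1F

others-distinct : ∀ k → proj₁ (others k) ≢ k × proj₂ (others k) ≢ k × proj₁ (others k) ≢ proj₂ (others k)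
others-distinct 0F = (λ ()) , (λ ()) , λ ()
others-distinct 1F = (λ ()) , (λ ()) , λ ()
others-distinct 2F = (λ ()) , (λ ()) , λ ()

AllPairs-∈ : {A : Set} {R : A → A → Set} → (∀ {x y} → R x y → R y x) →
             ∀ {xs x y} → AllPairs R xs → x ∈ xs → y ∈ xs → y ≡ x ⊎ R x y
AllPairs-∈ R-sym (rs ∷ _) (here refl) (here refl) = inj₁ refl
AllPairs-∈ R-sym (rs ∷ _) (here refl) (there y∈)  = inj₂ (All.lookup rs y∈)
AllPairs-∈ R-sym (rs ∷ _) (there x∈)  (here refl) = inj₂ (R-sym (All.lookup rs x∈))
AllPairs-∈ R-sym (_ ∷ r)  (there x∈)  (there y∈)  = AllPairs-∈ R-sym r x∈ y∈

record Outcome {m} (Good : Fin m → Position → Set) (d : Table {m}) : Set where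
  field
    symmetric   : Symmetric d
    irreflexive : Irreflexive d
    full        : ∀ {x y} → x ≢ y → d x y ≢ nothing
    invariant   : Invariant Good d

module Final {m} {Good : Fin m → Position → Set} {d : Table {m}} (o : Outcome Good d) where
  open Outcome o renaming (symmetric to d-sym; irreflexive to d-irr; full to d-full)
  open Invariant invariant

  Joined : Col → Vertex m → Vertex m → Set
  Joined x u v = d u v ≡ just x

  -- No vertex is joined to itself, so such a list has no repetitions and its length is the size of
  -- the clique.
  Clique : Col → List (Vertex m) → Set
  Clique x = AllPairs (Joined x)

  joined-sym : ∀ {x u v} → Joined x u v → Joined x v u
  joined-sym p = trans (d-sym _ _) p

  red≢blue : ∀ {u v} → Joined red u v → ¬ Joined blue u v
  red≢blue p q with () ← trans (sym p) q

  irr : ∀ {x u v} → u ≡ v → ¬ Joined x u v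
  irr refl p with () ← trans (sym (d-irr _)) p

  Beaten : List (Vertex m) → Set
  Beaten xs = ∃ λ ys → Clique blue ys × length xs < length ys

  state : Fin m → Position
  state i = proj₁ (pairs i)

  goal : ∀ i → Good i (state i)
  goal i = good (proj₁ (proj₂ (pairs i)))

  red-slot : ∀ i e → d at ends i e ≡ just red → Red (state i) e
  red-slot i e p = ≼-red (subst (state i e ≼_) p (proj₂ (proj₂ (pairs i)) e))

  -- The order `≼` never introduces red, and at the end of the game no edge is uncoloured; only blue
  -- remains.
  blue-slot : ∀ i e → Clear (state i) e → d at ends i e ≡ just blue
  blue-slot i e clear = blue-if (state i e) (d at ends i e) (proj₂ (proj₂ (pairs i)) e) clear
                                (d-full (ends-distinct i e))
    where
    blue-if : ∀ s x → s ≼ x → s ≢ just red → x ≢ nothing → x ≡ just blue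
    blue-if _ _           fill _ _ = refl
    blue-if _ nothing     keep _ n = contradiction refl n
    blue-if _ (just red)  keep r _ = contradiction refl r
    blue-if _ (just blue) keep _ _ = refl

  Pair : Set
  Pair = Fin m × Bool

  ⟦_⟧ : Pair → Vertex m
  ⟦ i , b ⟧ = limb i b

  mate : Pair → Pair
  mate (i , b) = i , not b

  rung-blue : ∀ p → Clear (state (proj₁ p)) rung → Joined blue ⟦ p ⟧ ⟦ mate p ⟧
  rung-blue (i , false) c = blue-slot i rung c
  rung-blue (i , true)  c = joined-sym (blue-slot i rung c)

  triangle : ∀ xs → length xs ≤ 2 → Beaten xs
  triangle _ len = core 0F ∷ core 1F ∷ core 2F ∷ [] ,
    (core-blue (λ ()) ∷ core-blue (λ ()) ∷ []) ∷ (core-blue (λ ()) ∷ []) ∷ [] ∷ [] , s≤s len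

  quad : ∀ i → Quad (state i) → ∀ xs → length xs ≤ 3 → Beaten xs
  quad i (inj₁ (b , clear)) _ len = core 0F ∷ core 1F ∷ core 2F ∷ limb i b ∷ [] ,
    (core-blue (λ ()) ∷ core-blue (λ ()) ∷ spoke-blue 0F ∷ []) ∷
    (core-blue (λ ()) ∷ spoke-blue 1F ∷ []) ∷ (spoke-blue 2F ∷ []) ∷ [] ∷ [] , s≤s len
    where
    spoke-blue : ∀ t → Joined blue (core t) (limb i b)
    spoke-blue t = blue-slot i (spoke t b) (clear t)
  quad i (inj₂ (clear , k , backed)) _ len =
    core (proj₁ (others k)) ∷ core (proj₂ (others k)) ∷ limb i false ∷ limb i true ∷ [] ,
    (core-blue l≢l′ ∷ spoke-blue _ l≢k ∷ spoke-blue _ l≢k ∷ []) ∷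
    (spoke-blue _ l′≢k ∷ spoke-blue _ l′≢k ∷ []) ∷ (blue-slot i rung clear ∷ []) ∷ [] ∷ [] , s≤s len
    where
    l≢k : proj₁ (others k) ≢ k
    l≢k = proj₁ (others-distinct k)
    l′≢k : proj₂ (others k) ≢ k
    l′≢k = proj₁ (proj₂ (others-distinct k))
    l≢l′ : proj₁ (others k) ≢ proj₂ (others k)
    l≢l′ = proj₂ (proj₂ (others-distinct k))
    spoke-blue : ∀ {t} b → t ≢ k → Joined blue (core t) (limb i b)
    spoke-blue {t} b t≢k = blue-slot i (spoke t b) (backed b t t≢k)

  -- The core is a blue triangle, so a red clique has at most one core vertex; it is moved to the
  -- front.
  split : ∀ xs → Clique red xs →
          (∃ λ ps → xs ↭ map ⟦_⟧ ps) ⊎ (∃₂ λ k ps → xs ↭ core k ∷ map ⟦_⟧ ps)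
  split [] [] = inj₁ ([] , ↭-refl)
  split (limb i b ∷ xs) (_ ∷ cl) with split xs cl
  ... | inj₁ (ps , xs↭)     = inj₁ ((i , b) ∷ ps , prep _ xs↭)
  ... | inj₂ (k , ps , xs↭) = inj₂ (k , (i , b) ∷ ps , ↭-trans (prep _ xs↭) (swap _ _ ↭-refl))
  split (core k ∷ xs) (rs ∷ cl) with split xs cl
  ... | inj₁ (ps , xs↭)     = inj₂ (k , ps , prep _ xs↭)
  ... | inj₂ (l , ps , xs↭) with All-resp-↭ xs↭ rs
  ...   | r ∷ _ = contradiction (core-blue λ { refl → irr refl r }) (red≢blue r)

  clique-↭ : ∀ {x xs ys} → xs ↭ ys → Clique x xs → Clique x ys
  clique-↭ xs↭ys = Permutation.AllPairs-resp-↭ (setoid (Vertex m)) joined-sym (resp₂ _) (↭⇒↭ₛ xs↭ys)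

  RedPair : Pair → Pair → Set
  RedPair = Joined red on ⟦_⟧

  Apart : Pair → Pair → Set
  Apart p q = proj₁ p ≢ proj₁ q × RedPair p q

  red-mate : ∀ {i b c} → RedPair (i , b) (i , c) → c ≡ not b
  red-mate r = ¬-not λ { refl → irr refl r }

  -- If `p` and `q` were mates, the third vertex `r` would lie in another pair and be joined in red
  -- to both of them, whereas two pairs have at most one red edge between them.
  apart : ∀ {p q r} → RedPair p q → RedPair p r → RedPair q r → proj₁ p ≢ proj₁ q
  apart {i , b} {_ , c} {j , e} pq pr qr refl with i Fin.≟ j
  ... | yes refl = irr (cong (limb i) (trans (red-mate pq) (sym (red-mate pr)))) qr
  ... | no i≢j with red-mate pq
  ...   | refl = red≢blue qr (proj₁ (cross b e i≢j pr))

  -- Every two vertices need a third one for `apart`: `r` serves for `p` and `q`, `q` for `p` and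
  -- any later vertex, and `p` for two vertices of the tail.
  all-apart : ∀ {ps} → 3 ≤ length ps → AllPairs RedPair ps → AllPairs Apart ps
  all-apart {p ∷ q ∷ r ∷ ps} _ ((pq ∷ pr ∷ pps) ∷ (qr ∷ qps) ∷ rps) =
    ((apart pq pr qr , pq) ∷ All.zipWith (λ (px , qx) → apart px pq (joined-sym qx) , px) (pr ∷ pps , qr ∷ qps)) ∷
    tail-apart (pq ∷ pr ∷ pps) ((qr ∷ qps) ∷ rps)
    where
    tail-apart : ∀ {xs} → All (RedPair p) xs → AllPairs RedPair xs → AllPairs Apart xs
    tail-apart []         []        = []
    tail-apart (px ∷ pxs) (xs ∷ rs) =
      All.zipWith (λ (py , xy) → apart xy (joined-sym px) (joined-sym py) , xy) (pxs , xs) ∷ tail-apart pxs rs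
  all-apart {[]} ()
  all-apart {_ ∷ []} (s≤s ())
  all-apart {_ ∷ _ ∷ []} (s≤s (s≤s ()))

  mates : List Pair → List (Vertex m)
  mates ps = map ⟦_⟧ (map mate ps)

  mates-length : ∀ ps → length (mates ps) ≡ length ps
  mates-length ps = trans (length-map ⟦_⟧ (map mate ps)) (length-map mate ps)

  mates-all : ∀ {P : Vertex m → Set} {ps} → All (P ∘ ⟦_⟧ ∘ mate) ps → All P (mates ps)
  mates-all h = All.map⁺ (All.map⁺ h)

  apart-mates : ∀ {p q} → Apart p q → Joined blue ⟦ mate p ⟧ ⟦ mate q ⟧
  apart-mates (i≢j , r) = proj₂ (proj₂ (cross _ _ i≢j r))

  apart-mate : ∀ {p q} → Apart p q → Joined blue ⟦ p ⟧ ⟦ mate q ⟧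
  apart-mate (i≢j , r) = proj₁ (proj₂ (cross _ _ i≢j r))

  apart-sym : ∀ {p q} → Apart p q → Apart q p
  apart-sym (i≢j , r) = i≢j ∘ sym , joined-sym r

  mates-blue : ∀ {ps} → AllPairs Apart ps → Clique blue (mates ps)
  mates-blue aps = AllPairs.map⁺ (AllPairs.map⁺ (AllPairs.map apart-mates aps))

  -- Its own mate is reached by the blue rung, the other mates by the blue edges that accompany a
  -- red cross edge.
  own-mates : ∀ {ps p} → AllPairs Apart ps → p ∈ ps → Clear (state (proj₁ p)) rung →
              All (Joined blue ⟦ p ⟧) (mates ps)
  own-mates {ps} {p} aps p∈ps clear = mates-all (All.tabulate joined)
    where
    joined : ∀ {q} → q ∈ ps → Joined blue ⟦ p ⟧ ⟦ mate q ⟧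
    joined q∈ps with AllPairs-∈ apart-sym aps p∈ps q∈ps
    ... | inj₁ refl = rung-blue p clear
    ... | inj₂ a    = apart-mate a

  red-spoke : ∀ {k ps i b} → All (Joined red (core k)) (map ⟦_⟧ ps) → (i , b) ∈ ps → Red (state i) (spoke k b)
  red-spoke {k} {i = i} {b} rs p∈ps = red-slot i (spoke k b) (All.lookup (All.map⁻ rs) p∈ps)

  beaten-↭ : ∀ {xs zs} → xs ↭ zs → Beaten zs → Beaten xs
  beaten-↭ xs↭zs (ys , cl , lt) = ys , cl , subst (_< length ys) (sym (↭-length xs↭zs)) lt

  -- The second hypothesis confines the alternative in `Lax` to one pair for each core vertex; the
  -- mates from the other pairs are backed.
  module _ (lax : ∀ i → Lax (state i))
           (one-slack : ∀ {i j k b c} → i ≢ j → Red (state i) (spoke k b) → ¬ Backed (state i) k (not b) →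
                        Red (state j) (spoke k c) → Backed (state j) k (not c)) where

    -- The mates form a blue clique of the same size, so one more vertex suffices: a member of the
    -- red clique with a blue rung, or core vertex `2F` if all rungs are red.
    beat-limbs : ∀ {ps} → AllPairs Apart ps → Beaten (map ⟦_⟧ ps)
    beat-limbs {ps} aps with Any.any? (λ p → clear? (state (proj₁ p)) rung) ps
    ... | yes some = let p , p∈ps , clear = find some in
          ⟦ p ⟧ ∷ mates ps , own-mates aps p∈ps clear ∷ mates-blue aps , longer
      where
      longer : length (map ⟦_⟧ ps) < suc (length (mates ps))
      longer = s≤s (≤-reflexive (trans (length-map ⟦_⟧ ps) (sym (mates-length ps))))
    ... | no none =
          core 2F ∷ mates ps , mates-all (All.map anchor (All.¬Any⇒All¬ ps none)) ∷ mates-blue aps , longer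
      where
      longer : length (map ⟦_⟧ ps) < suc (length (mates ps))
      longer = s≤s (≤-reflexive (trans (length-map ⟦_⟧ ps) (sym (mates-length ps))))
      anchor : ∀ {p} → ¬ Clear (state (proj₁ p)) rung → Joined blue (core 2F) ⟦ mate p ⟧
      anchor {i , b} ¬clear =
        blue-slot i (spoke 2F (not b)) (proj₂ (lax i) (decidable-stable (red? (state i) rung) ¬clear) (not b))

    -- Two vertices must be added to the mates: the other two core vertices if all mates are backed,
    -- and otherwise the core vertex `t` with the clique's vertex in the exceptional pair.
    beat-core : ∀ {k ps} → AllPairs Apart ps → All (Joined red (core k)) (map ⟦_⟧ ps) →
                Beaten (core k ∷ map ⟦_⟧ ps)
    beat-core {k} {ps} aps rs with All.all? (λ (i , b) → backed? (state i) k (not b)) ps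
    ... | yes backed =
          core l ∷ core l′ ∷ mates ps ,
          (core-blue l≢l′ ∷ mates-all (All.map (spoke-blue l≢k) backed)) ∷
          mates-all (All.map (spoke-blue l′≢k) backed) ∷ mates-blue aps ,
          longer
      where
      l l′ : Fin 3
      l  = proj₁ (others k)
      l′ = proj₂ (others k)
      l≢k : l ≢ k
      l≢k = proj₁ (others-distinct k)
      l′≢k : l′ ≢ k
      l′≢k = proj₁ (proj₂ (others-distinct k))
      l≢l′ : l ≢ l′
      l≢l′ = proj₂ (proj₂ (others-distinct k))
      spoke-blue : ∀ {t} → t ≢ k → ∀ {p} → Backed (state (proj₁ p)) k (not (proj₂ p)) → Joined blue (core t) ⟦ mate p ⟧
      spoke-blue {t} t≢k {i , b} back = blue-slot i (spoke t (not b)) (back t t≢k)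
      longer : suc (length (map ⟦_⟧ ps)) < suc (suc (length (mates ps)))
      longer = s≤s (s≤s (≤-reflexive (trans (length-map ⟦_⟧ ps) (sym (mates-length ps)))))
    ... | no ¬backed with find (All.¬All⇒Any¬ (λ (i , b) → backed? (state i) k (not b)) ps ¬backed)
    ...   | (i , b) , p∈ps , ¬back with proj₁ (lax i) k b (red-spoke rs p∈ps)
    ...     | inj₁ back = contradiction back ¬back
    ...     | inj₂ (clear , t , t≢k , both) =
          core t ∷ limb i b ∷ mates ps ,
          (blue-slot i (spoke t b) (both b) ∷ mates-all (All.tabulate joined)) ∷
          own-mates aps p∈ps clear ∷ mates-blue aps ,
          s≤s (s≤s (≤-reflexive (trans (length-map ⟦_⟧ ps) (sym (mates-length ps)))))
      where
      joined : ∀ {q} → q ∈ ps → Joined blue (core t) ⟦ mate q ⟧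
      joined {j , c} q∈ps with AllPairs-∈ apart-sym aps p∈ps q∈ps
      ... | inj₁ refl      = blue-slot i (spoke t (not b)) (both (not b))
      ... | inj₂ (i≢j , _) =
            blue-slot j (spoke t (not c)) (one-slack i≢j (red-spoke rs p∈ps) ¬back (red-spoke rs q∈ps) t t≢k)

    -- Four vertices leave at least three outside the core, which is what `all-apart` needs.
    beat-long : ∀ {xs} → 4 ≤ length xs → Clique red xs → Beaten xs
    beat-long {xs} len cl with split xs cl
    ... | inj₁ (ps , xs↭) =
          beaten-↭ xs↭ (beat-limbs (all-apart (≤-trans (n≤1+n 3) long) (AllPairs.map⁻ (clique-↭ xs↭ cl))))
      where
      long : 4 ≤ length ps
      long = subst (4 ≤_) (trans (↭-length xs↭) (length-map ⟦_⟧ ps)) len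
    ... | inj₂ (k , ps , xs↭) with clique-↭ xs↭ cl
    ...   | rs ∷ cl′ = beaten-↭ xs↭ (beat-core (all-apart (s≤s⁻¹ long) (AllPairs.map⁻ cl′)) rs)
      where
      long : 4 ≤ suc (length ps)
      long = subst (4 ≤_) (trans (↭-length xs↭) (cong suc (length-map ⟦_⟧ ps))) len

-- A single pair: five vertices

module _ {d : Table {1}} (o : Outcome (Goal 1) d) where
  open Final o

  -- Three vertices of a red clique outside the core would lie in different pairs, but there is only
  -- one pair.
  few : ∀ {ps} → AllPairs RedPair ps → length ps ≤ 2
  few {ps} rs with 3 ≤? length ps
  ... | no ¬3≤ = s≤s⁻¹ (≰⇒> ¬3≤)
  ... | yes 3≤ with all-apart 3≤ rs
  ...   | []                     = z≤n
  ...   | [] ∷ _                 = s≤s z≤n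
  few {(0F , _) ∷ (0F , _) ∷ _} _ | yes _ | ((0≢0 , _) ∷ _) ∷ _ = contradiction refl 0≢0

  -- The core triangle beats two vertices. A red clique of three consists of a core vertex and both
  -- sides of the pair; `Small` either excludes it or provides a blue clique of four.
  beaten-one-pair : ∀ {xs} → Clique red xs → Beaten xs
  beaten-one-pair {xs} cl with split xs cl
  ... | inj₁ (ps , xs↭) = beaten-↭ xs↭
          (triangle (map ⟦_⟧ ps) (≤-trans (≤-reflexive (length-map ⟦_⟧ ps)) (few (AllPairs.map⁻ (clique-↭ xs↭ cl)))))
  ... | inj₂ (k , ps , xs↭) with clique-↭ xs↭ cl
  ...   | rs ∷ cl′ = beaten-↭ xs↭ (beat ps rs (AllPairs.map⁻ cl′))
    where
    beat : ∀ ps → All (Joined red (core k)) (map ⟦_⟧ ps) → AllPairs RedPair ps → Beaten (core k ∷ map ⟦_⟧ ps)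
    beat []       _ _ = triangle (core k ∷ []) (s≤s z≤n)
    beat (p ∷ []) _ _ = triangle (core k ∷ ⟦ p ⟧ ∷ []) (s≤s (s≤s z≤n))
    beat ps@(_ ∷ _ ∷ _ ∷ _) _ rr with few rr
    ... | s≤s (s≤s ())
    beat ((0F , b) ∷ (0F , c) ∷ []) (p ∷ q ∷ []) ((r ∷ []) ∷ _) with goal 0F
    ... | inj₁ four  = quad 0F four (core k ∷ limb 0F b ∷ limb 0F c ∷ []) (s≤s (s≤s (s≤s z≤n)))
    ... | inj₂ ¬tri with red-mate r
    ...   | refl = contradiction (red-slot 0F rung (red-rung b r) , k , spokes b p q) ¬tri
      where
      red-rung : ∀ b → RedPair (0F , b) (0F , not b) → d at ends 0F rung ≡ just red
      red-rung false r = r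
      red-rung true  r = joined-sym r
      spokes : ∀ b → Joined red (core k) (limb 0F b) → Joined red (core k) (limb 0F (not b)) →
               ∀ e → Red (state 0F) (spoke k e)
      spokes false p q false = red-slot 0F (spoke k false) p
      spokes false p q true  = red-slot 0F (spoke k true) q
      spokes true  p q false = red-slot 0F (spoke k false) q
      spokes true  p q true  = red-slot 0F (spoke k true) p

-- Two or more pairs

module _ {m} {d : Table {suc (suc m)}} (o : Outcome (Goal (suc (suc m))) d) where
  open Final o

  strict : ∀ i → Strict (state (suc i))
  strict i = goal (suc i)

  lax : ∀ i → Lax (state i)
  lax zero    = goal zero
  lax (suc i) = (λ k b r → inj₁ (proj₁ (strict i) k b r)) , proj₁ (proj₂ (strict i))

  -- Only pair 0, which holds Alice's first edge, can fail to back its mates.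
  one-slack : ∀ {i j k b c} → i ≢ j → Red (state i) (spoke k b) → ¬ Backed (state i) k (not b) →
              Red (state j) (spoke k c) → Backed (state j) k (not c)
  one-slack {suc i}        _   r ¬back _ = contradiction (proj₁ (strict i) _ _ r) ¬back
  one-slack {zero} {zero}  i≢j _ _     _ = contradiction refl i≢j
  one-slack {zero} {suc j} _   _ _     r = proj₁ (strict j) _ _ r

  beaten-many-pairs : ∀ {xs} → Clique red xs → Beaten xs
  beaten-many-pairs {xs} cl with length xs ≤? 3
  -- Pair 1 exists here and is strict, so it yields a blue clique of four vertices.
  ... | yes short = quad 1F (proj₂ (proj₂ (strict zero))) xs short
  ... | no ¬short = beat-long lax one-slack (≰⇒> ¬short) cl

beaten : ∀ {m} {d : Table {suc m}} (o : Outcome (Goal (suc m)) d) →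
         ∀ {xs} → Final.Clique o red xs → Final.Beaten o xs
beaten {zero}  = beaten-one-pair
beaten {suc m} = beaten-many-pairs

-- Clique numbers

elements : ∀ {n} → Subset n → List (Fin n)
elements []            = []
elements (inside  ∷ S) = zero ∷ map suc (elements S)
elements (outside ∷ S) = map suc (elements S)

elements-length : ∀ {n} (S : Subset n) → length (elements S) ≡ ∣ S ∣
elements-length []            = refl
elements-length (inside  ∷ S) = cong suc (trans (length-map suc (elements S)) (elements-length S))
elements-length (outside ∷ S) = trans (length-map suc (elements S)) (elements-length S)

elements-∈ : ∀ {n} (S : Subset n) → All (_∈ˢ S) (elements S)
elements-∈ []            = []
elements-∈ (inside  ∷ S) = here ∷ All.map⁺ (All.map there (elements-∈ S))
elements-∈ (outside ∷ S) = All.map⁺ (All.map there (elements-∈ S))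

-- `isClique` inspects only the pairs with `i < j`, so the increasing order is what turns a
-- monochromatic subset into a clique in list form.
elements-sorted : ∀ {n} (S : Subset n) → AllPairs Fin._<_ (elements S)
elements-sorted []            = []
elements-sorted (inside  ∷ S) =
  All.map⁺ (All.map (λ _ → s≤s z≤n) (elements-∈ S)) ∷ AllPairs.map⁺ (AllPairs.map s≤s (elements-sorted S))
elements-sorted (outside ∷ S) = AllPairs.map⁺ (AllPairs.map s≤s (elements-sorted S))

fromElements : ∀ {n} → List (Fin n) → Subset n
fromElements = foldr (λ i S → ⁅ i ⁆ ∪ S) ∅

fromElements-∈ : ∀ {n} (is : List (Fin n)) {i} → i ∈ˢ fromElements is → i ∈ is
fromElements-∈ []       i∈ = contradiction i∈ ∉⊥
fromElements-∈ (j ∷ is) i∈ with x∈p∪q⁻ ⁅ j ⁆ (fromElements is) i∈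
... | inj₁ i∈j  = here (x∈⁅y⁆⇒x≡y j i∈j)
... | inj₂ i∈is = there (fromElements-∈ is i∈is)

fromElements-size : ∀ {n} {is : List (Fin n)} → AllPairs _≢_ is → length is ≤ ∣ fromElements is ∣
fromElements-size []                             = z≤n
fromElements-size {is = i ∷ is} (i≢is ∷ is-dist) =
  ≤-trans (s≤s (fromElements-size is-dist)) (p⊂q⇒∣p∣<∣q∣
    ( q⊆p∪q ⁅ i ⁆ (fromElements is) , i , p⊆p∪q (fromElements is) (x∈⁅x⁆ i)
    , λ i∈ → All.lookup i≢is (fromElements-∈ is i∈) refl))

∈-allSubsets : ∀ {n} (S : Subset n) → S ∈ allSubsets n
∈-allSubsets []            = here refl
∈-allSubsets (inside  ∷ S) = ∈-++⁺ˡ (∈-map⁺ _ (∈-allSubsets S))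
∈-allSubsets (outside ∷ S) = ∈-++⁺ʳ _ (∈-map⁺ _ (∈-allSubsets S))

foldr-⊔-< : ∀ {b} ns → 0 < b → All (_< b) ns → foldr _⊔_ 0 ns < b
foldr-⊔-< []       0<b []         = 0<b
foldr-⊔-< (n ∷ ns) 0<b (n<b ∷ h) = ⊔-lub n<b (foldr-⊔-< ns 0<b h)

≤-foldr-⊔ : ∀ {n} {ns} → n ∈ ns → n ≤ foldr _⊔_ 0 ns
≤-foldr-⊔ {ns = n ∷ ns} (here refl) = m≤m⊔n n _
≤-foldr-⊔ {ns = m ∷ ns} (there n∈)  = ≤-trans (≤-foldr-⊔ n∈) (m≤n⊔m m _)

hasCol⇒ : ∀ {s x} → T (hasCol s x) → s ≡ just x
hasCol⇒ {just red}  {red}  _ = refl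
hasCol⇒ {just blue} {blue} _ = refl

hasCol⇐ : ∀ x → T (hasCol (just x) x)
hasCol⇐ red  = _
hasCol⇐ blue = _

module _ {n} {c : Colouring n} where

  private
    entry : Col → Subset n → Fin n → Fin n → Bool
    entry x S i j = not (⌊ i Fin.<? j ⌋ ∧ ⌊ i ∈? S ⌋ ∧ ⌊ j ∈? S ⌋) ∨ hasCol (c i j) x

  isClique⇒ : ∀ {x S i j} → T (isClique c x S) → i Fin.< j → i ∈ˢ S → j ∈ˢ S → c i j ≡ just x
  isClique⇒ {x} {S} {i} {j} t i<j i∈S j∈S
    with i Fin.<? j | i ∈? S | j ∈? S | All.lookup (All.all⁺ (entry x S i) _ (All.lookup (All.all⁺ _ _ t) (∈-allFin i))) (∈-allFin j)
  ... | yes _ | yes _ | yes _ | h = hasCol⇒ h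
  ... | no ¬p | _     | _     | _ = contradiction i<j ¬p
  ... | yes _ | no ¬p | _     | _ = contradiction i∈S ¬p
  ... | yes _ | yes _ | no ¬p | _ = contradiction j∈S ¬p

  isClique⇐ : ∀ {x S} → (∀ {i j} → i Fin.< j → i ∈ˢ S → j ∈ˢ S → c i j ≡ just x) → T (isClique c x S)
  isClique⇐ {x} {S} h = All.all⁻ _ (All.tabulate {xs = allFin n} λ {i} _ →
                        All.all⁻ (entry x S i) (All.tabulate {xs = allFin n} λ {j} _ → holds i j))
    where
    holds : ∀ i j → T (entry x S i j)
    holds i j with i Fin.<? j | i ∈? S | j ∈? S
    ... | yes p | yes q | yes r rewrite h p q r = hasCol⇐ x
    ... | no _  | _     | _    = _
    ... | yes _ | no _  | _    = _
    ... | yes _ | yes _ | no _ = _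

  private
    score : Col → Subset n → ℕ
    score x S = if isClique c x S then ∣ S ∣ else 0

  module _ (c-sym : Symmetric c) (c-irr : Irreflexive c) where

    cliqueNumber-≥ : ∀ {x is} → AllPairs (λ i j → c i j ≡ just x) is → length is ≤ cliqueNumber c x
    cliqueNumber-≥ {x} {is} cl = ≤-trans (fromElements-size distinct)
      (subst (_≤ cliqueNumber c x) score≡ (≤-foldr-⊔ (∈-map⁺ (score x) (∈-allSubsets S))))
      where
      S : Subset n
      S = fromElements is
      distinct : AllPairs _≢_ is
      distinct = AllPairs.map (λ { p refl → contradiction (trans (sym p) (c-irr _)) λ () }) cl
      joined : ∀ {i j} → i Fin.< j → i ∈ˢ S → j ∈ˢ S → c i j ≡ just x
      joined i<j i∈S j∈S
        with AllPairs-∈ (λ p → trans (c-sym _ _) p) cl (fromElements-∈ is i∈S) (fromElements-∈ is j∈S)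
      ... | inj₁ j≡i = contradiction (sym j≡i) (Fin.<⇒≢ i<j)
      ... | inj₂ p   = p
      score≡ : score x S ≡ ∣ S ∣
      score≡ rewrite Equivalence.to T-≡ (isClique⇐ {x} {S} joined) = refl

    cliqueNumber-< : (∀ {is} → AllPairs (λ i j → c i j ≡ just red) is →
                       ∃ λ js → AllPairs (λ i j → c i j ≡ just blue) js × length is < length js) →
                     cliqueNumber c red < cliqueNumber c blue
    cliqueNumber-< beat = foldr-⊔-< _ positive (All.map⁺ (All.tabulate {xs = allSubsets n} λ {S} _ → smaller S))
      where
      positive : 0 < cliqueNumber c blue
      -- Beating the empty clique gives a nonempty blue one; this handles the base value 0 and the
      -- subsets that score 0.
      positive = let _ , cl , lt = beat [] in <-≤-trans lt (cliqueNumber-≥ cl)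
      smaller : ∀ S → score red S < cliqueNumber c blue
      smaller S with isClique c red S in eq
      ... | false = positive
      ... | true  = let _ , cl , lt = beat red-clique in
                    subst (_< cliqueNumber c blue) (elements-length S) (<-≤-trans lt (cliqueNumber-≥ cl))
        where
        red-clique : AllPairs (λ i j → c i j ≡ just red) (elements S)
        red-clique = sorted⇒ (elements-∈ S) (elements-sorted S)
          where
          sorted⇒ : ∀ {is} → All (_∈ˢ S) is → AllPairs Fin._<_ is → AllPairs (λ i j → c i j ≡ just red) is
          sorted⇒ []         []         = []
          sorted⇒ (i∈ ∷ is∈) (i< ∷ is<) =
            All.zipWith (λ (j∈ , i<j) → isClique⇒ {S = S} (Equivalence.from T-≡ eq) i<j i∈ j∈) (is∈ , i<)
            ∷ sorted⇒ is∈ is<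

-- Relabelling after Alice's first edge

transpose-hit : ∀ {n} (i j : Fin n) → Components.transpose i j i ≡ j
transpose-hit i j with i Fin.≟ i
... | yes _ = refl
... | no ¬p = contradiction refl ¬p

transpose-miss : ∀ {n} {i j k : Fin n} → k ≢ i → k ≢ j → Components.transpose i j k ≡ k
transpose-miss {i = i} {j} {k} k≢i k≢j with k Fin.≟ i
... | yes p = contradiction p k≢i
... | no _ with k Fin.≟ j
...   | yes p = contradiction p k≢j
...   | no _  = refl

Vertex↔ : ∀ m → Vertex m ↔ Fin (3 + m * 2)
Vertex↔ m = ↔-sym Fin.+↔⊎ ↔-∘ ((↔-id (Fin 3) ⊎-↔ ↔-sym (Fin.*↔× {m})) ↔-∘
            ((↔-id (Fin 3) ⊎-↔ (↔-id (Fin m) ×-↔ ↔-sym Fin.2↔Bool)) ↔-∘ unfold))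
  where
  unfold : Vertex m ↔ (Fin 3 ⊎ (Fin m × Bool))
  unfold = mk↔ₛ′ (λ { (core k) → inj₁ k ; (limb i b) → inj₂ (i , b) })
                 (λ { (inj₁ k) → core k ; (inj₂ (i , b)) → limb i b })
                 (λ { (inj₁ k) → refl ; (inj₂ (i , b)) → refl })
                 (λ { (core k) → refl ; (limb i b) → refl })

to-injective : ∀ {A B : Set} (φ : A ↔ B) {x y} → Inverse.to φ x ≡ Inverse.to φ y → x ≡ y
to-injective φ = Injection.injective (↔⇒↣ φ)

-- Two transpositions suffice: the first sends the image of `x` to `a`, and the second sends the new
-- image `y′` of `y` to `b`. It fixes `a`, which differs from both.
relabel : ∀ {A : Set} {n} (φ : A ↔ Fin n) {x y} → x ≢ y → ∀ {a b} → a ≢ b →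
          ∃ λ (ψ : A ↔ Fin n) → Inverse.to ψ x ≡ a × Inverse.to ψ y ≡ b
relabel {n = n} φ {x} {y} x≢y {a} {b} a≢b =
  transpose y′ b ↔-∘ (transpose (Inverse.to φ x) a ↔-∘ φ) ,
  trans (cong (Components.transpose y′ b) (transpose-hit (Inverse.to φ x) a))
        (transpose-miss a≢y′ a≢b) ,
  transpose-hit y′ b
  where
  φ′ : Fin n → Fin n
  φ′ = Components.transpose (Inverse.to φ x) a
  y′ : Fin n
  y′ = φ′ (Inverse.to φ y)
  a≢y′ : a ≢ y′
  a≢y′ p = x≢y (to-injective (transpose (Inverse.to φ x) a ↔-∘ φ)
                 (trans (transpose-hit (Inverse.to φ x) a) p))

-- The strategy carried over to the complete graph

module _ {m n} (ψ : Vertex (suc m) ↔ Fin n) where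
  open Inverse ψ using () renaming (to to vert; from to label)

  vert-label : ∀ i → vert (label i) ≡ i
  vert-label i = Inverse.strictlyInverseˡ ψ i

  vert-injective : ∀ {x y} → vert x ≡ vert y → x ≡ y
  vert-injective = to-injective ψ

  table : Colouring n → Table
  table c x y = c (vert x) (vert y)

  record Safe (c : Colouring n) : Set where
    field
      is-symmetric   : Symmetric c
      is-irreflexive : Irreflexive c
      invariant      : Invariant (Goal (suc m)) (table c)
  open Safe

  full-table : ∀ {c} → Symmetric c → Full c → ∀ {x y} → x ≢ y → table c x y ≢ nothing
  full-table c-sym full {x} {y} x≢y p with Fin.<-cmp (vert x) (vert y)
  ... | tri< u<v _ _ = full _ _ u<v p
  ... | tri≈ _ u≡v _ = x≢y (vert-injective u≡v)
  ... | tri> _ _ v<u = full _ _ v<u (trans (c-sym _ _) p)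

  safe-wins : ∀ {c} → Safe c → Full c → cliqueNumber c red < cliqueNumber c blue
  safe-wins {c} s full = cliqueNumber-< (is-symmetric s) (is-irreflexive s) beat
    where
    o : Outcome (Goal (suc m)) (table c)
    o = record
      { symmetric   = λ x y → is-symmetric s (vert x) (vert y)
      ; irreflexive = λ x → is-irreflexive s (vert x)
      ; full        = full-table (is-symmetric s) full
      ; invariant   = invariant s
      }
    beat : ∀ {is} → AllPairs (λ i j → c i j ≡ just red) is →
           ∃ λ js → AllPairs (λ i j → c i j ≡ just blue) js × length is < length js
    beat {is} cl =
      let ys , cl′ , lt = beaten o (AllPairs.map⁺ (AllPairs.map to-table cl))
      in map vert ys , AllPairs.map⁺ cl′ , subst₂ _<_ (length-map label is) (sym (length-map vert ys)) lt
      where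
      to-table : ∀ {i j} → c i j ≡ just red → table c (label i) (label j) ≡ just red
      to-table p = trans (cong₂ c (vert-label _) (vert-label _)) p

  vert² : Vertex (suc m) × Vertex (suc m) → Fin n × Fin n
  vert² (x , y) = vert x , vert y

  same-label : ∀ {i j x y} → SameEdge i j (vert x) (vert y) → SameEdge (label i) (label j) x y
  same-label (inj₁ (p , q)) = inj₁ (sym (Inverse.inverseʳ ψ (sym p)) , sym (Inverse.inverseʳ ψ (sym q)))
  same-label (inj₂ (p , q)) = inj₂ (sym (Inverse.inverseʳ ψ (sym p)) , sym (Inverse.inverseʳ ψ (sym q)))

  safe-reply : ∀ {c} → Safe c → ∀ {i j} → Free c i j → let c₁ = paint c i j red in
               ∃ λ es → length es ≤ 3 × All (Available c₁) es × (∀ {c′} → c₁ ⊑ c′ → All (Blue c′) es → Safe c′)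
  safe-reply {c} s {i} {j} (i<j , vacant)
    with reply-any (λ x y → is-symmetric s (vert x) (vert y)) (invariant s) (label i) (label j)
           (λ p → Fin.<⇒≢ i<j (trans (sym (vert-label i)) (trans (cong vert p) (vert-label j))))
           (trans (cong₂ c (vert-label i) (vert-label j)) vacant)
  ... | fs , len , ok , after =
        map vert² fs , ≤-trans (≤-reflexive (length-map vert² fs)) len ,
        All.map⁺ (All.map available ok) ,
        λ c₁⊑c′ blues → let c′-sym = symmetric c₁⊑c′ (paint-symmetric i j red (is-symmetric s)) in record
          { is-symmetric   = c′-sym
          ; is-irreflexive = irreflexive c₁⊑c′ (paint-irreflexive c red (Fin.<⇒≢ i<j) (is-irreflexive s))
          ; invariant      = after record
            { symmetric = λ x y → c′-sym (vert x) (vert y)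
            ; hit       = painted {c = c} c₁⊑c′ (inj₁ (vert-label i , vert-label j))
            ; miss      = λ (x , y) ¬same → subst (_≼ _) (paint-miss c i j red (¬same ∘ same-label))
                                                  (pointwise c₁⊑c′ (vert x) (vert y))
            } (All.map⁻ blues)
          }
    where
    available : ∀ {f} → Answerable (table c) (label i , label j) f → Available (paint c i j red) (vert² f)
    available (x≢y , not-red , ¬same) =
      x≢y ∘ vert-injective , λ p → not-red (trans (sym (paint-miss c i j red (¬same ∘ same-label))) p)

  safe-strategy : Strategy 2 Safe
  safe-strategy = record { sym-I = is-symmetric ; final = safe-wins ; reply = safe-reply }

-- The opening turn and the conclusion

start : ∀ {m} → Fin (suc m) → Position
start zero    = opened
start (suc _) = vacant

start-survives : ∀ m i → Survives (Goal (suc m) i) (start i)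
start-survives zero    zero    = small-survives
start-survives (suc m) zero    = lax-survives
start-survives (suc m) (suc i) = strict-survives

core-triangle : ∀ {m} → List (Vertex m × Vertex m)
core-triangle = (core 0F , core 1F) ∷ (core 0F , core 2F) ∷ (core 1F , core 2F) ∷ []

-- The only red edge so far is a slot of pair 0, so the condition on cross edges holds vacuously and
-- every other pair starts from `vacant`.
opening : ∀ m {n} (ψ : Vertex (suc m) ↔ Fin n) → let open Inverse ψ in
          ∀ {c′} → let i = to (core 0F) ; j = to (limb 0F false) in
          paint (empty n) i j red ⊑ c′ → All (Blue c′) (map (vert² ψ) core-triangle) → Safe ψ c′
opening m {n} ψ {c′} c₁⊑c′ (b₀₁ ∷ b₀₂ ∷ b₁₂ ∷ []) = record
  { is-symmetric   = c′-sym
  ; is-irreflexive = irreflexive c₁⊑c′ (paint-irreflexive (empty n) red i≢j λ _ → refl)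
  ; invariant      = record
    { core-blue = core-blue
    ; cross     = λ b c k≢l p → contradiction p (cross-not-red k≢l)
    ; pairs     = λ k → start k , start-survives m k , extends k
    }
  }
  where
  open Inverse ψ using () renaming (to to vert)
  i j : Fin n
  i = vert (core 0F)
  j = vert (limb 0F false)
  i≢j : i ≢ j
  i≢j p with () ← vert-injective ψ p
  c′-sym : Symmetric c′
  c′-sym = symmetric c₁⊑c′ (paint-symmetric {c = empty n} i j red λ _ _ → refl)
  core-blue : ∀ {k l} → k ≢ l → c′ (vert (core k)) (vert (core l)) ≡ just blue
  core-blue {0F} {1F} _ = b₀₁
  core-blue {0F} {2F} _ = b₀₂
  core-blue {1F} {2F} _ = b₁₂
  core-blue {1F} {0F} _ = trans (c′-sym _ _) b₀₁
  core-blue {2F} {0F} _ = trans (c′-sym _ _) b₀₂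
  core-blue {2F} {1F} _ = trans (c′-sym _ _) b₁₂
  core-blue {0F} {0F} k≢l = contradiction refl k≢l
  core-blue {1F} {1F} k≢l = contradiction refl k≢l
  core-blue {2F} {2F} k≢l = contradiction refl k≢l
  same : ∀ {x y} → SameEdge i j (vert x) (vert y) → SameEdge (core 0F) (limb 0F false) x y
  same (inj₁ (p , q)) = inj₁ (vert-injective ψ p , vert-injective ψ q)
  same (inj₂ (p , q)) = inj₂ (vert-injective ψ p , vert-injective ψ q)
  untouched : ∀ {x y} → ¬ SameEdge (core 0F) (limb 0F false) x y → nothing ≼ c′ (vert x) (vert y)
  untouched {x} {y} ¬same =
    subst (_≼ c′ (vert x) (vert y)) (paint-miss (empty n) i j red (¬same ∘ same)) (pointwise c₁⊑c′ (vert x) (vert y))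
  cross-not-red : ∀ {k l b c} → k ≢ l → c′ (vert (limb k b)) (vert (limb l c)) ≢ just red
  cross-not-red k≢l p with subst (nothing ≼_) p (untouched λ { (inj₁ (() , _)) ; (inj₂ (_ , ())) })
  ... | ()
  extends : ∀ k → Extends (start k) (table ψ c′) k
  extends zero    e with spoke 0F false ≟ˢ e
  ... | yes refl = subst (just red ≼_) (sym (painted {c = empty n} c₁⊑c′ (inj₁ (refl , refl)))) keep
  ... | no ¬e    = untouched (λ h → ¬e (proj₂ (ends-injective {i = zero} {zero} (spoke 0F false) e h)))
  extends (suc k) e = untouched λ h → contradiction (proj₁ (ends-injective {i = zero} {suc k} (spoke 0F false) e h)) λ ()

odd-player2Wins : ∀ m → Player2Wins 1 3 (3 + suc m * 2)
odd-player2Wins m = aliceMove (λ full → full 0F 1F (s≤s z≤n) refl) reply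
  where
  n : ℕ
  n = 3 + suc m * 2
  edges : List (Fin n × Fin n)
  edges = cartesianProduct (allFin n) (allFin n)
  reply : ∀ i j → Free (empty n) i j → BobWins 1 3 (bobP 3) (paint (empty n) i j red)
  -- The labelling is chosen after Alice's first edge, which thereby becomes the slot
  -- `spoke 0F false` of pair 0.
  reply i j (i<j , _) with relabel (Vertex↔ (suc m)) {core 0F} {limb 0F false} (λ ()) (Fin.<⇒≢ i<j)
  ... | ψ , refl , refl =
    -- The first turn is an ordinary turn in which the core triangle is owed. The argument `2`
    -- stands for three moves, and all ordered pairs of vertices serve as the list that contains the
    -- free edges.
    bob (safe-strategy ψ) (length edges) 2 (λ u v _ → ∈-cartesianProduct⁺ (∈-allFin u) (∈-allFin v)) ≤-refl
        (paint-symmetric {c = empty n} _ _ red λ _ _ → refl) (map (vert² ψ) core-triangle) ≤-refl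
        (available 0F 1F (λ ()) ∷ available 0F 2F (λ ()) ∷ available 1F 2F (λ ()) ∷ [])
        (opening m ψ)
    where
    available : ∀ k l → k ≢ l → Available (paint (empty n) _ _ red) (vert² ψ (core k , core l))
    available k l k≢l = (λ p → k≢l (core-injective (to-injective ψ p))) ,
      λ p → contradiction (trans (sym (paint-miss (empty n) _ _ red not-first)) p) λ ()
      where
      core-injective : ∀ {k l} → core {suc m} k ≡ core l → k ≡ l
      core-injective refl = refl
      core≢limb : ∀ {k i b} → Inverse.to ψ (core k) ≢ Inverse.to ψ (limb i b)
      core≢limb p with () ← to-injective ψ p
      not-first : ¬ SameEdge (Inverse.to ψ (core 0F)) (Inverse.to ψ (limb 0F false))
                             (Inverse.to ψ (core k)) (Inverse.to ψ (core l))
      not-first (inj₁ (_ , q)) = core≢limb q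
      not-first (inj₂ (p , _)) = core≢limb p

theorem4p2 : (n : ℕ) → 5 ≤ n → n % 2 ≡ 1 → Player2Wins 1 3 n
theorem4p2 n 5≤n odd with n / 2 | subst (λ r → n ≡ r + n / 2 * 2) odd (m≡m%n+[m/n]*n n 2)
theorem4p2 _ (s≤s ())             _ | 0             | refl
theorem4p2 _ (s≤s (s≤s (s≤s ()))) _ | 1             | refl
-- `1 + (2 + m) * 2` computes to `3 + (1 + m) * 2`: the core and `1 + m` pairs.
theorem4p2 _ _                    _ | suc (suc m)   | refl = odd-player2Wins m
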